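{- For any prime $p$, $f(3) \leq 4$.
   Context: $\mathbb{Z}_p$ is the ring of $p$-adic integers and $M_n(\mathbb{Z}_p)$ is the ring of $n \times n$ matrices over $\mathbb{Z}_p$. A form $\sum_{i=1}^m a_i X_i^2$ with $a_i \in \mathbb{Z}_p$ is universal over $M_n(\mathbb{Z}_p)$ if for every $A \in M_n(\mathbb{Z}_p)$ there exist $X_1, \ldots, X_m \in M_n(\mathbb{Z}_p)$ with $A = \sum_{i=1}^m a_i X_i^2$. For a fixed prime $p$ and an integer $n \geq 3$, $f(n)$ is the smallest integer $m \geq 3$ such that for all $p$-adic integers $a_1, a_2, \ldots, a_m$ with at least three of them (counted by index) units, the form $\sum_{i=1}^m a_i X_i^2$ is universal over $M_n(\mathbb{Z}_p)$. -}

module Defs where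

open import Algebra.Bundles using (CommutativeRing)
open import Algebra.Definitions using (Invertible)
import Algebra.Definitions.RawMonoid as RawMonoidDefinitions
open import Data.Fin.Base using (Fin)
open import Data.Integer.Base as ℤ using (ℤ; +_; 0ℤ; 1ℤ)
open import Data.Integer.Divisibility.Signed
  using (_∣_; divides; ∣m∣n⇒∣m+n; ∣m⇒∣-m; ∣m⇒∣m*n; ∣n⇒∣m*n)
import Data.Integer.Properties as ℤ
open import Data.Integer.Tactic.RingSolver using (solve-∀)
open import Data.Nat.Base as ℕ using (ℕ; suc)
open import Data.Product.Base using (Σ-syntax; _×_; _,_)
open import Data.Vec.Functional using (Vector)
open import Function.Definitions using (Injective)
open import Level using (Level; 0ℓ)
open import Relation.Binary.PropositionalEquality using (_≡_; refl; subst)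

------------------------------------------------------------------------
-- Congruence of integers

infix 4 _≡_[mod_]

_≡_[mod_] : ℤ → ℤ → ℤ → Set
a ≡ b [mod m ] = m ∣ (a ℤ.- b)

module _ {m : ℤ} where

  ≡⇒≡mod : ∀ {a b} → a ≡ b → a ≡ b [mod m ]
  ≡⇒≡mod {a} refl = divides 0ℤ (ℤ.+-inverseʳ a)

  ≡mod-sym : ∀ {a b} → a ≡ b [mod m ] → b ≡ a [mod m ]
  ≡mod-sym {a} {b} h = subst (m ∣_) (lemma a b) (∣m⇒∣-m h)
    where
    lemma : ∀ a b → ℤ.- (a ℤ.- b) ≡ b ℤ.- a
    lemma = solve-∀

  ≡mod-trans : ∀ {a b c} → a ≡ b [mod m ] → b ≡ c [mod m ] → a ≡ c [mod m ]
  ≡mod-trans {a} {b} {c} h k = subst (m ∣_) (lemma a b c) (∣m∣n⇒∣m+n h k)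
    where
    lemma : ∀ a b c → (a ℤ.- b) ℤ.+ (b ℤ.- c) ≡ a ℤ.- c
    lemma = solve-∀

  +-≡mod : ∀ {a b c d} → a ≡ b [mod m ] → c ≡ d [mod m ] →
           a ℤ.+ c ≡ b ℤ.+ d [mod m ]
  +-≡mod {a} {b} {c} {d} h k = subst (m ∣_) (lemma a b c d) (∣m∣n⇒∣m+n h k)
    where
    lemma : ∀ a b c d → (a ℤ.- b) ℤ.+ (c ℤ.- d) ≡ (a ℤ.+ c) ℤ.- (b ℤ.+ d)
    lemma = solve-∀

  neg-≡mod : ∀ {a b} → a ≡ b [mod m ] → ℤ.- a ≡ ℤ.- b [mod m ]
  neg-≡mod {a} {b} h = subst (m ∣_) (lemma a b) (∣m⇒∣-m h)
    where
    lemma : ∀ a b → ℤ.- (a ℤ.- b) ≡ ℤ.- a ℤ.- ℤ.- b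
    lemma = solve-∀

  *-≡mod : ∀ {a b c d} → a ≡ b [mod m ] → c ≡ d [mod m ] →
           a ℤ.* c ≡ b ℤ.* d [mod m ]
  *-≡mod {a} {b} {c} {d} h k =
    subst (m ∣_) (lemma a b c d) (∣m∣n⇒∣m+n (∣n⇒∣m*n a k) (∣m⇒∣m*n d h))
    where
    lemma : ∀ a b c d →
            a ℤ.* (c ℤ.- d) ℤ.+ (a ℤ.- b) ℤ.* d ≡ a ℤ.* c ℤ.- b ℤ.* d
    lemma = solve-∀

------------------------------------------------------------------------
-- The p-adic integers, as the inverse limit of ℤ / pᵏ

-- Each residue class modulo pᵏ is given by an arbitrary integer
-- representative; `_≈ₚ_` below identifies different choices of these.
record ℤₚ (p : ℕ) : Set where
  constructor mkℤₚ
  field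
    residue  : ℕ → ℤ
    coherent : ∀ k → residue (suc k) ≡ residue k [mod + (p ℕ.^ k) ]

open ℤₚ public

module _ {p : ℕ} where

  infix  4 _≈ₚ_
  infixl 6 _+ₚ_
  infixl 7 _*ₚ_
  infix  8 -ₚ_

  -- A record, so that x and y can be inferred from a proof of x ≈ₚ y.
  record _≈ₚ_ (x y : ℤₚ p) : Set where
    constructor mk≈ₚ
    field
      residue-≈ : ∀ k → residue x k ≡ residue y k [mod + (p ℕ.^ k) ]

  open _≈ₚ_ public

  fromℤ : ℤ → ℤₚ p
  fromℤ a = mkℤₚ (λ _ → a) (λ _ → ≡⇒≡mod {a = a} refl)

  _+ₚ_ : ℤₚ p → ℤₚ p → ℤₚ p
  residue  (x +ₚ y) k = residue x k ℤ.+ residue y k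
  coherent (x +ₚ y) k =
    +-≡mod {a = residue x (suc k)} {b = residue x k} (coherent x k) (coherent y k)

  _*ₚ_ : ℤₚ p → ℤₚ p → ℤₚ p
  residue  (x *ₚ y) k = residue x k ℤ.* residue y k
  coherent (x *ₚ y) k =
    *-≡mod {a = residue x (suc k)} {b = residue x k} (coherent x k) (coherent y k)

  -ₚ_ : ℤₚ p → ℤₚ p
  residue  (-ₚ x) k = ℤ.- residue x k
  coherent (-ₚ x) k = neg-≡mod {a = residue x (suc k)} (coherent x k)

  pointwise : ∀ {x y : ℤₚ p} → (∀ k → residue x k ≡ residue y k) → x ≈ₚ y
  pointwise h = mk≈ₚ λ k → ≡⇒≡mod (h k)

-- 0 and 1 are the constant sequences; all laws hold residue by residue.
ℤₚ-commutativeRing : ℕ → CommutativeRing 0ℓ 0ℓ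
ℤₚ-commutativeRing p = record
  { Carrier = ℤₚ p
  ; _≈_ = _≈ₚ_
  ; _+_ = _+ₚ_
  ; _*_ = _*ₚ_
  ; -_  = -ₚ_
  ; 0#  = fromℤ 0ℤ
  ; 1#  = fromℤ 1ℤ
  ; isCommutativeRing = record
    { isRing = record
      { +-isAbelianGroup = record
        { isGroup = record
          { isMonoid = record
            { isSemigroup = record
              { isMagma = record
                { isEquivalence = record
                  { refl  = pointwise λ _ → refl
                  ; sym   = λ {x} {y} h → mk≈ₚ λ k →
                      ≡mod-sym {a = residue x k} (residue-≈ h k)
                  ; trans = λ {x} {y} {z} g h → mk≈ₚ λ k →
                      ≡mod-trans {a = residue x k} {b = residue y k}
                        (residue-≈ g k) (residue-≈ h k)
                  }
                ; ∙-cong = λ {x} {y} g h → mk≈ₚ λ k →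
                    +-≡mod {a = residue x k} {b = residue y k}
                      (residue-≈ g k) (residue-≈ h k)
                }
              ; assoc = λ x y z → pointwise λ k →
                  ℤ.+-assoc (residue x k) (residue y k) (residue z k)
              }
            ; identity = (λ x → pointwise λ k → ℤ.+-identityˡ (residue x k))
                       , (λ x → pointwise λ k → ℤ.+-identityʳ (residue x k))
            }
          ; inverse = (λ x → pointwise λ k → ℤ.+-inverseˡ (residue x k))
                    , (λ x → pointwise λ k → ℤ.+-inverseʳ (residue x k))
          ; ⁻¹-cong = λ {x} h → mk≈ₚ λ k →
              neg-≡mod {a = residue x k} (residue-≈ h k)
          }
        ; comm = λ x y → pointwise λ k → ℤ.+-comm (residue x k) (residue y k)
        }
      ; *-cong = λ {x} {y} g h → mk≈ₚ λ k →
          *-≡mod {a = residue x k} {b = residue y k}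
            (residue-≈ g k) (residue-≈ h k)
      ; *-assoc = λ x y z → pointwise λ k →
          ℤ.*-assoc (residue x k) (residue y k) (residue z k)
      ; *-identity = (λ x → pointwise λ k → ℤ.*-identityˡ (residue x k))
                   , (λ x → pointwise λ k → ℤ.*-identityʳ (residue x k))
      ; distrib = (λ x y z → pointwise λ k →
                    ℤ.*-distribˡ-+ (residue x k) (residue y k) (residue z k))
                , (λ x y z → pointwise λ k →
                    ℤ.*-distribʳ-+ (residue x k) (residue y k) (residue z k))
      }
    ; *-comm = λ x y → pointwise λ k → ℤ.*-comm (residue x k) (residue y k)
    }
  }

------------------------------------------------------------------------
-- Diagonal quadratic forms over matrix rings

module DiagonalForms {c ℓ : Level} (R : CommutativeRing c ℓ) where

  open CommutativeRing R
  open RawMonoidDefinitions +-rawMonoid using (sum)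

  infix  4 _≋_
  infixl 7 _⊠_

  Matrix : ℕ → Set c
  Matrix n = Fin n → Fin n → Carrier

  _≋_ : ∀ {n} → Matrix n → Matrix n → Set ℓ
  A ≋ B = ∀ i j → A i j ≈ B i j

  _⊠_ : ∀ {n} → Matrix n → Matrix n → Matrix n
  (A ⊠ B) i j = sum λ k → A i k * B k j

  diagonalForm : ∀ {m n} → Vector Carrier m → Vector (Matrix n) m → Matrix n
  diagonalForm a X i j = sum λ l → a l * (X l ⊠ X l) i j

  Universal : ∀ {m} → ℕ → Vector Carrier m → Set _
  Universal {m} n a =
    ∀ (A : Matrix n) → Σ[ X ∈ Vector (Matrix n) m ] A ≋ diagonalForm a X

  IsUnit : Carrier → Set _
  IsUnit = Invertible _≈_ 1# _*_

  -- Counted by index: equal coefficients at distinct positions count separately.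
  AtLeastThreeUnits : ∀ {m} → Vector Carrier m → Set _
  AtLeastThreeUnits {m} a =
    Σ[ ι ∈ (Fin 3 → Fin m) ] Injective _≡_ _≡_ ι × (∀ t → IsUnit (a (ι t)))

------------------------------------------------------------------------
-- The invariant f(n)

Admissible : (p n m : ℕ) → Set
Admissible p n m =
  3 ℕ.≤ m × (∀ (a : Vector (ℤₚ p) m) → AtLeastThreeUnits a → Universal n a)
  where open DiagonalForms (ℤₚ-commutativeRing p)

-- "f(n) = m" for the prime p.  The graph of f is used because a nonempty set of
-- naturals need not constructively have a least element.
f[_,_]≡_ : (p n m : ℕ) → Set
f[ p , n ]≡ m = Admissible p n m × (∀ k → Admissible p n k → m ℕ.≤ k)

{-# OPTIONS --safe #-}

-- Write A in blocks of sizes 1 and 2. If the 2 × 2 blocks M and N are invertible,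
-- the squares of [0 0; u M] and [0 v; 0 N] contribute an arbitrary first column
-- M u and an arbitrary first row v N, while the square of a bordering of P by the
-- row (z r t) and the column (z 1 0) makes the entries (1,1) and (2,3) arbitrary.
-- So a X² + b Y² + c Z² = A reduces to three scalar equations for the 2 × 2 form
-- a M² + b N² + c P². By Cayley–Hamilton a block of trace t squares to
-- t M − det M, so fixing the traces makes these equations linear; their
-- coefficients are units, except for a factor 2 in the difference of the diagonal
-- entries. For p = 2 the free entry z adjusts the parity of that difference.

module Submission where

open import Defs
open import Algebra.Bundles using (CommutativeRing; RawRing)
import Algebra.Definitions.RawMonoid as RawMonoidDefinitions
import Algebra.Properties.CommutativeMonoid.Sum as SumProperties
import Algebra.Solver.Ring as RingSolver
open import Algebra.Solver.Ring.AlmostCommutativeRing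
  using (fromCommutativeRing; _-Raw-AlmostCommutative⟶_)
open import Data.Fin using (Fin; zero; suc; #_)
open import Data.Fin.Patterns using (0F; 1F; 2F)
open import Data.Fin.Properties using (_≟_; any?; suc-injective)
open import Data.Integer.Base as ℤ using (ℤ; +_; 0ℤ; 1ℤ; -1ℤ)
open import Data.Integer.Divisibility.Signed
  using (_∣_; divides; ∣m∣n⇒∣m+n; ∣n⇒∣m*n; ∣-trans; *-cancelˡ-∣; *-monoʳ-∣)
import Data.Integer.DivMod as ℤ
import Data.Integer.Properties as ℤ
open import Data.Integer.Tactic.RingSolver using (solve-∀)
open import Data.Maybe.Base using (Maybe; just; nothing)
open import Data.Nat.Base as ℕ using (ℕ; zero; suc; _≤_; s≤s)
import Data.Nat.Divisibility as ℕ
open import Data.Nat.DivMod using (m%n<n; m≡m%n+[m/n]*n)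
open import Data.Nat.Primality using (Prime; prime⇒irreducible)
import Data.Nat.Properties as ℕ
open import Data.Product.Base using (∃; ∃₂; ∃-syntax; Σ-syntax; _×_; _,_; proj₁; proj₂)
open import Data.Sum.Base using (_⊎_; inj₁; inj₂; [_,_]′)
open import Data.Vec.Base as Vec using (Vec)
open import Data.Vec.Functional using (Vector; []; _∷_)
open import Function.Base using (_∘_)
open import Function.Definitions using (Injective)
open import Level using (Level)
open import Relation.Binary.PropositionalEquality as ≡ using (_≡_; _≢_)
import Relation.Binary.Reasoning.Setoid as SetoidReasoning
open import Relation.Nullary using (¬_; Dec; yes; no; contradiction)

private
  variable
    c ℓ : Level

-- Block matrices of shape 1 + 2

-- Over a raw ring, so that the same matrices can be formed over the polynomial
-- expressions of the ring solver.
module Blocks (R : RawRing c ℓ) where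
  open RawRing R
  open RawMonoidDefinitions +-rawMonoid using (sum)

  form : ∀ {m n} → Vector Carrier m → Vector (Fin n → Fin n → Carrier) m →
         Fin n → Fin n → Carrier
  form a X i j = sum λ l → a l * sum λ k → X l i k * X l k j

  mat : Carrier → Carrier → Carrier → Carrier → Fin 2 → Fin 2 → Carrier
  mat p q r s = (p ∷ q ∷ []) ∷ (r ∷ s ∷ []) ∷ []

  det : (Fin 2 → Fin 2 → Carrier) → Carrier
  det M = M 0F 0F * M 1F 1F + - (M 0F 1F * M 1F 0F)

  -- The column is adj(M) w, so that the square has the column det(M) w.
  lower : Vector Carrier 2 → (Fin 2 → Fin 2 → Carrier) → Fin 3 → Fin 3 → Carrier
  lower w M =
    (0# ∷ 0# ∷ 0# ∷ []) ∷
    (M 1F 1F * w 0F + - (M 0F 1F * w 1F) ∷ M 0F 0F ∷ M 0F 1F ∷ []) ∷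
    (M 0F 0F * w 1F + - (M 1F 0F * w 0F) ∷ M 1F 0F ∷ M 1F 1F ∷ []) ∷ []

  upper : Vector Carrier 2 → (Fin 2 → Fin 2 → Carrier) → Fin 3 → Fin 3 → Carrier
  upper w N =
    (0# ∷ w 0F * N 1F 1F + - (w 1F * N 1F 0F) ∷ w 1F * N 0F 0F + - (w 0F * N 0F 1F) ∷ []) ∷
    (0# ∷ N 0F 0F ∷ N 0F 1F ∷ []) ∷
    (0# ∷ N 1F 0F ∷ N 1F 1F ∷ []) ∷ []

  bordered : Carrier → Carrier → Carrier → (Fin 2 → Fin 2 → Carrier) →
             Fin 3 → Fin 3 → Carrier
  bordered z r t P =
    (z ∷ r ∷ t ∷ []) ∷ (1# ∷ P 0F 0F ∷ P 0F 1F ∷ []) ∷ (0# ∷ P 1F 0F ∷ P 1F 1F ∷ []) ∷ []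

-- Ternary forms with unit coefficients over a commutative ring

module Representation (R : CommutativeRing c ℓ)
  (ℤ⟶R : ℤ.+-*-rawRing -Raw-AlmostCommutative⟶ fromCommutativeRing R) where

  open CommutativeRing R
  open DiagonalForms R
  open Blocks rawRing using (mat; det; lower; upper; bordered)
  open SetoidReasoning setoid

  private
    module ℤ⟶R = _-Raw-AlmostCommutative⟶_ ℤ⟶R

    -- Adjusted so that the solver's constants 0 and 1 are 0# and 1# on the nose.
    constant : ℤ → Carrier
    constant (+ 0) = 0#
    constant (+ 1) = 1#
    constant i = ℤ⟶R.⟦ i ⟧

    constant≈ : ∀ i → constant i ≈ ℤ⟶R.⟦ i ⟧
    constant≈ (+ 0) = sym ℤ⟶R.0-homo
    constant≈ (+ 1) = sym ℤ⟶R.1-homo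
    constant≈ (+ suc (suc _)) = refl
    constant≈ ℤ.-[1+ _ ] = refl

    constant-homomorphism : ℤ.+-*-rawRing -Raw-AlmostCommutative⟶ fromCommutativeRing R
    constant-homomorphism = record
      { ⟦_⟧ = constant
      ; +-homo = λ i j → trans (constant≈ (i ℤ.+ j)) (trans (ℤ⟶R.+-homo i j)
                           (sym (+-cong (constant≈ i) (constant≈ j))))
      ; *-homo = λ i j → trans (constant≈ (i ℤ.* j)) (trans (ℤ⟶R.*-homo i j)
                           (sym (*-cong (constant≈ i) (constant≈ j))))
      ; -‿homo = λ i → trans (constant≈ (ℤ.- i)) (trans (ℤ⟶R.-‿homo i)
                         (sym (-‿cong (constant≈ i))))
      ; 0-homo = refl
      ; 1-homo = refl
      }

    constant-≟ : ∀ i j → Maybe (constant i ≈ constant j)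
    constant-≟ i j with i ℤ.≟ j
    ... | yes ≡.refl = just refl
    ... | no _ = nothing

  open RingSolver ℤ.+-*-rawRing (fromCommutativeRing R) constant-homomorphism constant-≟

  polynomialRawRing : ℕ → RawRing _ _
  polynomialRawRing n = record
    { Carrier = Polynomial n ; _≈_ = _≡_ ; _+_ = _:+_ ; _*_ = _:*_
    ; -_ = :-_ ; 0# = con 0ℤ ; 1# = con 1ℤ }

  module 𝔹 {n} = Blocks (polynomialRawRing n)

  module BlockForm (a : Vector Carrier 3) (M N P : Matrix 2) (z r t : Carrier)
                   (u v : Vector Carrier 2) where

    X : Vector (Matrix 3) 3
    X = lower u M ∷ upper v N ∷ bordered z r t P ∷ []

    D : Matrix 2
    D = diagonalForm a (M ∷ N ∷ P ∷ [])

    private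
      env : Vec Carrier 22
      env =
        a 0F Vec.∷ a 1F Vec.∷ a 2F Vec.∷
        M 0F 0F Vec.∷ M 0F 1F Vec.∷ M 1F 0F Vec.∷ M 1F 1F Vec.∷
        N 0F 0F Vec.∷ N 0F 1F Vec.∷ N 1F 0F Vec.∷ N 1F 1F Vec.∷
        P 0F 0F Vec.∷ P 0F 1F Vec.∷ P 1F 0F Vec.∷ P 1F 1F Vec.∷
        z Vec.∷ r Vec.∷ t Vec.∷ u 0F Vec.∷ u 1F Vec.∷ v 0F Vec.∷ v 1F Vec.∷ Vec.[]

      x : Fin 22 → Polynomial 22
      x = var

      a′ = x (# 0) ∷ x (# 1) ∷ x (# 2) ∷ []
      M′ = 𝔹.mat (x (# 3)) (x (# 4)) (x (# 5)) (x (# 6))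
      N′ = 𝔹.mat (x (# 7)) (x (# 8)) (x (# 9)) (x (# 10))
      P′ = 𝔹.mat (x (# 11)) (x (# 12)) (x (# 13)) (x (# 14))
      z′ = x (# 15)
      r′ = x (# 16)
      t′ = x (# 17)
      u′ = x (# 18) ∷ x (# 19) ∷ []
      v′ = x (# 20) ∷ x (# 21) ∷ []

      -- The form is expanded symbolically: evaluating `entry i j` at `env` unfolds to
      -- `diagonalForm a X i j`, so each entry below is a single polynomial identity.
      entry : Fin 3 → Fin 3 → Polynomial 22
      entry = 𝔹.form a′ (𝔹.lower u′ M′ ∷ 𝔹.upper v′ N′ ∷ 𝔹.bordered z′ r′ t′ P′ ∷ [])

      D′ : Fin 2 → Fin 2 → Polynomial 22
      D′ = 𝔹.form a′ (M′ ∷ N′ ∷ P′ ∷ [])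

    entry₀₀ : diagonalForm a X 0F 0F ≈ a 2F * r + a 2F * (z * z)
    entry₀₀ = prove env (entry 0F 0F) (a′ 2F :* r′ :+ a′ 2F :* (z′ :* z′)) refl

    entry₀₁ : diagonalForm a X 0F 1F ≈
              a 1F * det N * v 0F + a 2F * (z * r + (r * P 0F 0F + t * P 1F 0F))
    entry₀₁ = prove env (entry 0F 1F)
      (a′ 1F :* 𝔹.det N′ :* v′ 0F :+
       a′ 2F :* (z′ :* r′ :+ (r′ :* P′ 0F 0F :+ t′ :* P′ 1F 0F))) refl

    entry₀₂ : diagonalForm a X 0F 2F ≈
              a 1F * det N * v 1F + a 2F * (z * t + (r * P 0F 1F + t * P 1F 1F))
    entry₀₂ = prove env (entry 0F 2F)
      (a′ 1F :* 𝔹.det N′ :* v′ 1F :+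
       a′ 2F :* (z′ :* t′ :+ (r′ :* P′ 0F 1F :+ t′ :* P′ 1F 1F))) refl

    entry₁₀ : diagonalForm a X 1F 0F ≈ a 0F * det M * u 0F + a 2F * (z + P 0F 0F)
    entry₁₀ = prove env (entry 1F 0F)
      (a′ 0F :* 𝔹.det M′ :* u′ 0F :+ a′ 2F :* (z′ :+ P′ 0F 0F)) refl

    entry₂₀ : diagonalForm a X 2F 0F ≈ a 0F * det M * u 1F + a 2F * P 1F 0F
    entry₂₀ = prove env (entry 2F 0F)
      (a′ 0F :* 𝔹.det M′ :* u′ 1F :+ a′ 2F :* P′ 1F 0F) refl

    entry₁₁ : diagonalForm a X 1F 1F ≈ a 2F * r + D 0F 0F
    entry₁₁ = prove env (entry 1F 1F) (a′ 2F :* r′ :+ D′ 0F 0F) refl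

    entry₁₂ : diagonalForm a X 1F 2F ≈ a 2F * t + D 0F 1F
    entry₁₂ = prove env (entry 1F 2F) (a′ 2F :* t′ :+ D′ 0F 1F) refl

    entry₂₁ : diagonalForm a X 2F 1F ≈ D 1F 0F
    entry₂₁ = prove env (entry 2F 1F) (D′ 1F 0F) refl

    entry₂₂ : diagonalForm a X 2F 2F ≈ D 1F 1F
    entry₂₂ = prove env (entry 2F 2F) (D′ 1F 1F) refl

  Represented : Vector Carrier 3 → Matrix 3 → Set _
  Represented a A = Σ[ X ∈ Vector (Matrix 3) 3 ] A ≋ diagonalForm a X

  2# : Carrier
  2# = 1# + 1#

  Even Odd : Carrier → Set _
  Even x = ∃[ h ] x ≈ 2# * h
  Odd x = ∃[ h ] x ≈ 1# + 2# * h

  unit-cong : ∀ {x y} → x ≈ y → IsUnit x → IsUnit y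
  unit-cong x≈y (x⁻¹ , invˡ , invʳ) =
    x⁻¹ , trans (*-congˡ (sym x≈y)) invˡ , trans (*-congʳ (sym x≈y)) invʳ

  unit : ∀ {x} y → x * y ≈ 1# → IsUnit x
  unit y xy≈1 = y , trans (*-comm _ _) xy≈1 , xy≈1

  factor-unit : ∀ {x y z} → x * y ≈ z → IsUnit z → IsUnit x
  factor-unit {x} {y} xy≈z (z⁻¹ , _ , zz⁻¹≈1) =
    unit (y * z⁻¹) (trans (sym (*-assoc x y z⁻¹)) (trans (*-congʳ xy≈z) zz⁻¹≈1))

  1-unit : IsUnit 1#
  1-unit = unit 1# (*-identityʳ 1#)

  -1-unit : IsUnit (- 1#)
  -1-unit = unit (- 1#) (solve 0 ((:- con 1ℤ) :* (:- con 1ℤ) := con 1ℤ) refl)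

  *-unit : ∀ {x y} → IsUnit x → IsUnit y → IsUnit (x * y)
  *-unit {x} {y} (x⁻¹ , _ , xx⁻¹≈1) (y⁻¹ , _ , yy⁻¹≈1) = unit (x⁻¹ * y⁻¹) (begin
    x * y * (x⁻¹ * y⁻¹)    ≈⟨ solve 4 (λ x y x⁻¹ y⁻¹ →
                                x :* y :* (x⁻¹ :* y⁻¹) := x :* x⁻¹ :* (y :* y⁻¹))
                              refl x y x⁻¹ y⁻¹ ⟩
    x * x⁻¹ * (y * y⁻¹)    ≈⟨ *-cong xx⁻¹≈1 yy⁻¹≈1 ⟩
    1# * 1#                ≈⟨ *-identityʳ 1# ⟩
    1#                     ∎)

  -- Used for every unknown that occurs with a unit coefficient `x`; `k` collects the rest of its
  -- equation.
  solveAffine : ∀ {x} → IsUnit x → ∀ k y → ∃[ w ] x * w + k ≈ y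
  solveAffine {x} (x⁻¹ , _ , xx⁻¹≈1) k y = x⁻¹ * (y + - k) , (begin
    x * (x⁻¹ * (y + - k)) + k  ≈⟨ solve 4 (λ x x⁻¹ k y →
                                    x :* (x⁻¹ :* (y :- k)) :+ k := x :* x⁻¹ :* (y :- k) :+ k)
                                  refl x x⁻¹ k y ⟩
    x * x⁻¹ * (y + - k) + k    ≈⟨ +-congʳ (*-congʳ xx⁻¹≈1) ⟩
    1# * (y + - k) + k         ≈⟨ solve 2 (λ k y → con 1ℤ :* (y :- k) :+ k := y) refl k y ⟩
    y                          ∎)

  solveLinear : ∀ {x} → IsUnit x → ∀ y → ∃[ w ] x * w ≈ y
  solveLinear ux y with w , eq ← solveAffine ux 0# y = w , trans (sym (+-identityʳ _)) eq

  -- The invertibility of det M and det N makes the first column and the first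
  -- row free; what is left of A are two entries and one trace-like condition.
  blocks-suffice :
    ∀ (a : Vector Carrier 3) → (∀ t → IsUnit (a t)) → (A : Matrix 3) →
    ∀ M N P z → IsUnit (det M) → IsUnit (det N) →
    let D = diagonalForm a (M ∷ N ∷ P ∷ []) in
    A 0F 0F + D 0F 0F ≈ A 1F 1F + a 2F * (z * z) →
    D 1F 0F ≈ A 2F 1F → D 1F 1F ≈ A 2F 2F →
    Represented a A
  blocks-suffice a ua A M N P z uM uN traces D₁₀ D₁₁ = X , A≋
    where
    -- `r` and `t` come first, from the entries (1,1) and (2,3), because the equations for the first
    -- row contain them.
    Σr = solveAffine (ua 2F) (a 2F * (z * z)) (A 0F 0F)
    Σt = solveAffine (ua 2F) (diagonalForm a (M ∷ N ∷ P ∷ []) 0F 1F) (A 1F 2F)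
    r = proj₁ Σr
    t = proj₁ Σt
    Σu₀ = solveAffine (*-unit (ua 0F) uM) (a 2F * (z + P 0F 0F)) (A 1F 0F)
    Σu₁ = solveAffine (*-unit (ua 0F) uM) (a 2F * P 1F 0F) (A 2F 0F)
    Σv₀ = solveAffine (*-unit (ua 1F) uN)
            (a 2F * (z * r + (r * P 0F 0F + t * P 1F 0F))) (A 0F 1F)
    Σv₁ = solveAffine (*-unit (ua 1F) uN)
            (a 2F * (z * t + (r * P 0F 1F + t * P 1F 1F))) (A 0F 2F)
    open BlockForm a M N P z r t (proj₁ Σu₀ ∷ proj₁ Σu₁ ∷ []) (proj₁ Σv₀ ∷ proj₁ Σv₁ ∷ [])

    -- `r` occurs in the entries (1,1) and (2,2); `traces` says exactly that the value found from
    -- (1,1) also fits (2,2).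
    corner : a 2F * r + D 0F 0F ≈ A 1F 1F
    corner = begin
      a 2F * r + D 0F 0F
        ≈⟨ solve 3 (λ p q s → p :+ q := p :+ s :+ q :- s) refl _ _ (a 2F * (z * z)) ⟩
      a 2F * r + a 2F * (z * z) + D 0F 0F + - (a 2F * (z * z))
        ≈⟨ +-congʳ (trans (+-congʳ (proj₂ Σr)) traces) ⟩
      A 1F 1F + a 2F * (z * z) + - (a 2F * (z * z))
        ≈⟨ solve 2 (λ p s → p :+ s :- s := p) refl _ _ ⟩
      A 1F 1F ∎

    A≋ : A ≋ diagonalForm a X
    A≋ 0F 0F = sym (trans entry₀₀ (proj₂ Σr))
    A≋ 0F 1F = sym (trans entry₀₁ (proj₂ Σv₀))
    A≋ 0F 2F = sym (trans entry₀₂ (proj₂ Σv₁))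
    A≋ 1F 0F = sym (trans entry₁₀ (proj₂ Σu₀))
    A≋ 1F 1F = sym (trans entry₁₁ corner)
    A≋ 1F 2F = sym (trans entry₁₂ (proj₂ Σt))
    A≋ 2F 0F = sym (trans entry₂₀ (proj₂ Σu₁))
    A≋ 2F 1F = sym (trans entry₂₁ D₁₀)
    A≋ 2F 2F = sym (trans entry₂₂ D₁₁)

  -- Explicit choices of the 2 × 2 blocks

  module _ (a : Vector Carrier 3) (ua : ∀ t → IsUnit (a t)) (A : Matrix 3) where

    -- Write a, b, c for the coefficients. `M` and `N` have trace 1 and determinants 1 and -2, and
    -- `P` has trace 0, so M² = M - 1, N² = N + 2 and P² = p. Hence `D 1F 0F` is a + b n, and the
    -- diagonal entries of `D` differ by a (2m - 1) + 3b.
    represented-if-2-unit : ∀ {m n p} → IsUnit 2# →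
      a 1F * n + a 0F ≈ A 2F 1F →
      a 0F * 2# * m + (A 0F 0F + (A 2F 2F + (- a 0F + (2# + 1#) * a 1F))) ≈ A 1F 1F →
      a 2F * p + (a 1F + - (a 0F * m)) ≈ A 2F 2F →
      Represented a A
    represented-if-2-unit {m} {n} {p} u2 n-eq m-eq p-eq =
      blocks-suffice a ua A M N P 0#
        (unit-cong (solve 1 (λ m → con 1ℤ := 𝔹.det (M′ m)) refl m) 1-unit)
        (unit-cong (solve 1 (λ n → (:- con 1ℤ) :* (con 1ℤ :+ con 1ℤ) := 𝔹.det (N′ n)) refl n)
          (*-unit -1-unit u2))
        traces
        (trans (solve 6 (λ a b c m n p → D′ a b c m n p 1F 0F := b :* n :+ a)
          refl (a 0F) (a 1F) (a 2F) m n p) n-eq)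
        (trans (solve 6 (λ a b c m n p → D′ a b c m n p 1F 1F := c :* p :+ (b :- a :* m))
          refl (a 0F) (a 1F) (a 2F) m n p) p-eq)
      where
      M = mat m (m * (1# + - m) + - 1#) 1# (1# + - m)
      N = mat 2# 0# n (- 1#)
      P = mat 0# p 1# 0#
      D = diagonalForm a (M ∷ N ∷ P ∷ [])

      M′ N′ P′ : ∀ {k} → Polynomial k → Fin 2 → Fin 2 → Polynomial k
      M′ m = 𝔹.mat m (m :* (con 1ℤ :- m) :- con 1ℤ) (con 1ℤ) (con 1ℤ :- m)
      N′ n = 𝔹.mat (con 1ℤ :+ con 1ℤ) (con 0ℤ) n (:- con 1ℤ)
      P′ p = 𝔹.mat (con 0ℤ) p (con 1ℤ) (con 0ℤ)

      D′ : ∀ {k} → (a b c m n p : Polynomial k) → Fin 2 → Fin 2 → Polynomial k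
      D′ a b c m n p = 𝔹.form (a ∷ b ∷ c ∷ []) (M′ m ∷ N′ n ∷ P′ p ∷ [])

      traces : A 0F 0F + D 0F 0F ≈ A 1F 1F + a 2F * (0# * 0#)
      traces = begin
        A 0F 0F + D 0F 0F
          ≈⟨ solve 7 (λ a b c m n p α →
               α :+ D′ a b c m n p 0F 0F :=
               a :* (con 1ℤ :+ con 1ℤ) :* m :+
               (α :+ (c :* p :+ (b :- a :* m) :+
                 (:- a :+ (con 1ℤ :+ con 1ℤ :+ con 1ℤ) :* b))))
             refl (a 0F) (a 1F) (a 2F) m n p (A 0F 0F) ⟩
        a 0F * 2# * m + (A 0F 0F +
          (a 2F * p + (a 1F + - (a 0F * m)) + (- a 0F + (2# + 1#) * a 1F)))
          ≈⟨ +-congˡ (+-congˡ (+-congʳ p-eq)) ⟩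
        a 0F * 2# * m + (A 0F 0F + (A 2F 2F + (- a 0F + (2# + 1#) * a 1F)))
          ≈⟨ m-eq ⟩
        A 1F 1F
          ≈⟨ solve 2 (λ x c → x := x :+ c :* (con 0ℤ :* con 0ℤ)) refl (A 1F 1F) (a 2F) ⟩
        A 1F 1F + a 2F * (0# * 0#) ∎

    -- Both M and N are the matrix of trace 1 and determinant 1 whose square has lower right entry
    -- 0. `P` has trace 1, so P² has lower left entry p and its diagonal entries differ by 2q - 1;
    -- the trace condition becomes 2q = s + z². The factor `1#` matches `halve-adding-square` at e =
    -- 1.
    represented-if-odd : ∀ {p q s w z} →
      a 2F * p + (a 0F + a 1F) ≈ A 2F 1F →
      a 2F * s + (A 0F 0F + (A 2F 2F + (- a 0F + - a 1F + - a 2F))) ≈ A 1F 1F →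
      2# * q ≈ s + 1# * (z * z) →
      a 2F * p * w + a 2F * ((1# + - q) * (1# + - q)) ≈ A 2F 2F →
      Represented a A
    represented-if-odd {p} {q} {s} {w} {z} p-eq s-eq q-eq w-eq =
      blocks-suffice a ua A M M P z M-unit M-unit traces
        (trans (solve 6 (λ a b c p q w → D′ a b c p q w 1F 0F := c :* p :+ (a :+ b))
          refl (a 0F) (a 1F) (a 2F) p q w) p-eq)
        (trans (solve 6 (λ a b c p q w →
            D′ a b c p q w 1F 1F := c :* p :* w :+ c :* ((con 1ℤ :- q) :* (con 1ℤ :- q)))
          refl (a 0F) (a 1F) (a 2F) p q w) w-eq)
      where
      M = mat 0# (- 1#) 1# 1#
      P = mat q w p (1# + - q)
      D = diagonalForm a (M ∷ M ∷ P ∷ [])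

      M′ : ∀ {k} → Fin 2 → Fin 2 → Polynomial k
      M′ = 𝔹.mat (con 0ℤ) (:- con 1ℤ) (con 1ℤ) (con 1ℤ)

      D′ : ∀ {k} → (a b c p q w : Polynomial k) → Fin 2 → Fin 2 → Polynomial k
      D′ a b c p q w =
        𝔹.form (a ∷ b ∷ c ∷ []) (M′ ∷ M′ ∷ 𝔹.mat q w p (con 1ℤ :- q) ∷ [])

      M-unit : IsUnit (det M)
      M-unit = unit-cong (solve 0 (con 1ℤ := 𝔹.det M′) refl) 1-unit

      traces : A 0F 0F + D 0F 0F ≈ A 1F 1F + a 2F * (z * z)
      traces = begin
        A 0F 0F + D 0F 0F
          ≈⟨ solve 7 (λ a b c p q w α →
               α :+ D′ a b c p q w 0F 0F :=
               c :* ((con 1ℤ :+ con 1ℤ) :* q) :+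
               (α :+ (c :* p :* w :+ c :* ((con 1ℤ :- q) :* (con 1ℤ :- q)) :+
                 (:- a :- b :- c))))
             refl (a 0F) (a 1F) (a 2F) p q w (A 0F 0F) ⟩
        a 2F * (2# * q) + (A 0F 0F +
          (a 2F * p * w + a 2F * ((1# + - q) * (1# + - q)) + (- a 0F + - a 1F + - a 2F)))
          ≈⟨ +-cong (*-congˡ q-eq) (+-congˡ (+-congʳ w-eq)) ⟩
        a 2F * (s + 1# * (z * z)) +
          (A 0F 0F + (A 2F 2F + (- a 0F + - a 1F + - a 2F)))
          ≈⟨ solve 4 (λ c s z k → c :* (s :+ con 1ℤ :* (z :* z)) :+ k :=
                                  c :* s :+ k :+ c :* (z :* z))
             refl (a 2F) s z _ ⟩
        a 2F * s + (A 0F 0F + (A 2F 2F + (- a 0F + - a 1F + - a 2F))) + a 2F * (z * z)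
          ≈⟨ +-congʳ s-eq ⟩
        A 1F 1F + a 2F * (z * z) ∎

    -- `M` has trace 1 and determinant 1, and so has `N` because n y = 1. The trace condition is a
    -- (2m) = a s + c z², and c = a e turns it into 2m = s + e z². Here `p` is the upper right entry
    -- of `P`, not the element whose parity is tested.
    represented-if-even : ∀ {e m n p s y z} →
      a 1F * n + a 0F ≈ A 2F 1F → n * y ≈ 1# → a 0F * e ≈ a 2F →
      a 0F * s + (A 0F 0F + (A 2F 2F + (- a 0F + - a 1F))) ≈ A 1F 1F →
      2# * m ≈ s + e * (z * z) →
      a 2F * p + - (a 0F * m) ≈ A 2F 2F →
      Represented a A
    represented-if-even {e} {m} {n} {p} {s} {y} {z} n-eq y-eq e-eq s-eq m-eq p-eq =
      blocks-suffice a ua A M N P z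
        (unit-cong (solve 1 (λ m → con 1ℤ := 𝔹.det (M′ m)) refl m) 1-unit)
        (unit-cong (trans (sym y-eq)
            (solve 2 (λ n y → n :* y := 𝔹.det (N′ n y)) refl n y)) 1-unit)
        traces
        (trans (solve 7 (λ a b c m n y p → D′ a b c m n y p 1F 0F := b :* n :+ a)
          refl (a 0F) (a 1F) (a 2F) m n y p) n-eq)
        D₁₁
      where
      M = mat m (m * (1# + - m) + - 1#) 1# (1# + - m)
      N = mat 0# (- y) n 1#
      P = mat 0# p 1# 0#
      D = diagonalForm a (M ∷ N ∷ P ∷ [])

      M′ P′ : ∀ {k} → Polynomial k → Fin 2 → Fin 2 → Polynomial k
      M′ m = 𝔹.mat m (m :* (con 1ℤ :- m) :- con 1ℤ) (con 1ℤ) (con 1ℤ :- m)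
      P′ p = 𝔹.mat (con 0ℤ) p (con 1ℤ) (con 0ℤ)

      N′ : ∀ {k} → Polynomial k → Polynomial k → Fin 2 → Fin 2 → Polynomial k
      N′ n y = 𝔹.mat (con 0ℤ) (:- y) n (con 1ℤ)

      D′ : ∀ {k} → (a b c m n y p : Polynomial k) → Fin 2 → Fin 2 → Polynomial k
      D′ a b c m n y p = 𝔹.form (a ∷ b ∷ c ∷ []) (M′ m ∷ N′ n y ∷ P′ p ∷ [])

      D₁₁ : D 1F 1F ≈ A 2F 2F
      D₁₁ = begin
        D 1F 1F
          ≈⟨ solve 7 (λ a b c m n y p →
               D′ a b c m n y p 1F 1F := c :* p :- a :* m :+ b :* (con 1ℤ :- n :* y))
             refl (a 0F) (a 1F) (a 2F) m n y p ⟩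
        a 2F * p + - (a 0F * m) + a 1F * (1# + - (n * y))
          ≈⟨ +-cong p-eq (*-congˡ (+-congˡ (-‿cong y-eq))) ⟩
        A 2F 2F + a 1F * (1# + - 1#)
          ≈⟨ solve 2 (λ x b → x :+ b :* (con 1ℤ :- con 1ℤ) := x) refl (A 2F 2F) (a 1F) ⟩
        A 2F 2F ∎

      traces : A 0F 0F + D 0F 0F ≈ A 1F 1F + a 2F * (z * z)
      traces = begin
        A 0F 0F + D 0F 0F
          ≈⟨ solve 8 (λ a b c m n y p α →
               α :+ D′ a b c m n y p 0F 0F :=
               a :* ((con 1ℤ :+ con 1ℤ) :* m) :+
               (α :+ (c :* p :- a :* m :+ (:- a :- b :* (n :* y)))))
             refl (a 0F) (a 1F) (a 2F) m n y p (A 0F 0F) ⟩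
        a 0F * (2# * m) + (A 0F 0F +
          (a 2F * p + - (a 0F * m) + (- a 0F + - (a 1F * (n * y)))))
          ≈⟨ +-cong (*-congˡ m-eq) (+-congˡ (+-cong p-eq
               (+-congˡ (-‿cong (trans (*-congˡ y-eq) (*-identityʳ (a 1F))))))) ⟩
        a 0F * (s + e * (z * z)) + (A 0F 0F + (A 2F 2F + (- a 0F + - a 1F)))
          ≈⟨ solve 5 (λ a s e z k → a :* (s :+ e :* (z :* z)) :+ k :=
                                    a :* s :+ k :+ a :* e :* (z :* z))
             refl (a 0F) s e z _ ⟩
        a 0F * s + (A 0F 0F + (A 2F 2F + (- a 0F + - a 1F))) + a 0F * e * (z * z)
          ≈⟨ +-cong s-eq (*-congʳ e-eq) ⟩
        A 1F 1F + a 2F * (z * z) ∎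

    -- The equations are triangular: in the one for `m` the lower right entry of `D` is already
    -- replaced by its target, which removes `p`, and `p` is found last. The coefficient 2a of `m`
    -- is where 2 has to be a unit.
    representable-2-unit : IsUnit 2# → Represented a A
    representable-2-unit u2 =
      let n , n-eq = solveAffine (ua 1F) (a 0F) (A 2F 1F)
          m , m-eq = solveAffine (*-unit (ua 0F) u2)
            (A 0F 0F + (A 2F 2F + (- a 0F + (2# + 1#) * a 1F))) (A 1F 1F)
          p , p-eq = solveAffine (ua 2F) (a 1F + - (a 0F * m)) (A 2F 2F)
      in represented-if-2-unit u2 n-eq m-eq p-eq

    -- Rings in which every element is even or odd, modelled on ℤ₂

    module _ (parity : ∀ x → Even x ⊎ Odd x) (odd-unit : ∀ x → Odd x → IsUnit x) where

      -- One of z = 0 and z = 1 works, since adding the odd `e` changes the parity of `s`.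
      halve-adding-square : ∀ {e} → Odd e → ∀ s → ∃₂ λ z m → 2# * m ≈ s + e * (z * z)
      halve-adding-square {e} (g , e-eq) s with parity s
      ... | inj₁ (h , s-eq) = 0# , h , trans (sym s-eq)
              (solve 2 (λ s e → s := s :+ e :* (con 0ℤ :* con 0ℤ)) refl s e)
      ... | inj₂ (h , s-eq) = 1# , h + g + 1# , (begin
              2# * (h + g + 1#)
                ≈⟨ solve 2 (λ h g → (con 1ℤ :+ con 1ℤ) :* (h :+ g :+ con 1ℤ) :=
                     (con 1ℤ :+ (con 1ℤ :+ con 1ℤ) :* h) :+
                     (con 1ℤ :+ (con 1ℤ :+ con 1ℤ) :* g) :* (con 1ℤ :* con 1ℤ)) refl h g ⟩
              1# + 2# * h + (1# + 2# * g) * (1# * 1#)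
                ≈⟨ +-cong (sym s-eq) (*-congʳ (sym e-eq)) ⟩
              s + e * (1# * 1#) ∎)

      1-odd : Odd 1#
      1-odd = 0# , solve 0 (con 1ℤ := con 1ℤ :+ (con 1ℤ :+ con 1ℤ) :* con 0ℤ) refl

      -- The parity of p, defined by c p + a + b = A₃₂, separates the cases: if p is a
      -- unit it may be the lower left entry of P; otherwise (A₃₂ − a) / b is a unit and
      -- may be that of N.
      representable-odd : ∀ {p} → a 2F * p + (a 0F + a 1F) ≈ A 2F 1F → Odd p →
                          Represented a A
      representable-odd {p} p-eq p-odd =
        let s , s-eq = solveAffine (ua 2F)
              (A 0F 0F + (A 2F 2F + (- a 0F + - a 1F + - a 2F))) (A 1F 1F)
            z , q , q-eq = halve-adding-square 1-odd s
            w , w-eq = solveAffine (*-unit (ua 2F) (odd-unit p p-odd))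
              (a 2F * ((1# + - q) * (1# + - q))) (A 2F 2F)
        in represented-if-odd p-eq s-eq q-eq w-eq

      representable-even : ∀ {p} → a 2F * p + (a 0F + a 1F) ≈ A 2F 1F → Even p →
                           Represented a A
      representable-even {p} p-eq (h , h-eq) with solveLinear (ua 0F) (a 2F)
      ... | e , e-eq with parity e
      -- If e = c / a is even, then 2 divides the unit c and is itself a unit.
      ...   | inj₁ (f , f-eq) = representable-2-unit (factor-unit {y = f * a 0F} (begin
                2# * (f * a 0F)    ≈⟨ solve 2 (λ f a →
                                        (con 1ℤ :+ con 1ℤ) :* (f :* a) :=
                                        a :* ((con 1ℤ :+ con 1ℤ) :* f)) refl f (a 0F) ⟩
                a 0F * (2# * f)    ≈⟨ *-congˡ (sym f-eq) ⟩
                a 0F * e           ≈⟨ e-eq ⟩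
                a 2F               ∎) (ua 2F))
      ...   | inj₂ e-odd =
        -- With p = 2h, the required n = (A₃₂ - a) / b equals 1 + 2 (c h / b). It is built in this
        -- form so that it is visibly odd.
        let g , g-eq = solveLinear (ua 1F) (a 2F * h)
            n = 1# + 2# * g
            n-eq : a 1F * n + a 0F ≈ A 2F 1F
            n-eq = begin
              a 1F * n + a 0F
                ≈⟨ solve 3 (λ a b g → b :* (con 1ℤ :+ (con 1ℤ :+ con 1ℤ) :* g) :+ a :=
                     (con 1ℤ :+ con 1ℤ) :* (b :* g) :+ (a :+ b)) refl (a 0F) (a 1F) g ⟩
              2# * (a 1F * g) + (a 0F + a 1F)
                ≈⟨ +-congʳ (*-congˡ g-eq) ⟩
              2# * (a 2F * h) + (a 0F + a 1F)
                ≈⟨ +-congʳ (solve 2 (λ c h → (con 1ℤ :+ con 1ℤ) :* (c :* h) :=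
                     c :* ((con 1ℤ :+ con 1ℤ) :* h)) refl (a 2F) h) ⟩
              a 2F * (2# * h) + (a 0F + a 1F)
                ≈⟨ +-congʳ (*-congˡ (sym h-eq)) ⟩
              a 2F * p + (a 0F + a 1F)
                ≈⟨ p-eq ⟩
              A 2F 1F ∎
            y , y-eq = solveLinear (odd-unit n (g , refl)) 1#
            s , s-eq = solveAffine (ua 0F)
              (A 0F 0F + (A 2F 2F + (- a 0F + - a 1F))) (A 1F 1F)
            z , m , m-eq = halve-adding-square e-odd s
            _ , w-eq = solveAffine (ua 2F) (- (a 0F * m)) (A 2F 2F)
        in represented-if-even n-eq y-eq e-eq s-eq m-eq w-eq

      representable-parity : Represented a A
      representable-parity =
        let p , p-eq = solveAffine (ua 2F) (a 0F + a 1F) (A 2F 1F)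
        in [ representable-even p-eq , representable-odd p-eq ]′ (parity p)

-- Setting variables to zero

module Padding (R : CommutativeRing c ℓ) where

  open CommutativeRing R hiding (zero)
  open DiagonalForms R
  open SumProperties +-commutativeMonoid
  open SetoidReasoning setoid

  sum-zero : ∀ {n} (f : Vector Carrier n) → (∀ i → f i ≈ 0#) → sum f ≈ 0#
  sum-zero {n} f f≈0 = trans (sum-cong-≋ f≈0) (sum-replicate-zero n)

  sum-single : ∀ {n} (i : Fin n) (f : Vector Carrier n) →
               (∀ j → j ≢ i → f j ≈ 0#) → sum f ≈ f i
  sum-single zero f f≈0 =
    trans (+-congˡ (sum-zero (f ∘ suc) λ j → f≈0 (suc j) λ ())) (+-identityʳ _)
  sum-single (suc i) f f≈0 =
    trans (+-cong (f≈0 zero λ ())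
             (sum-single i (f ∘ suc) λ j j≢i → f≈0 (suc j) (j≢i ∘ suc-injective)))
          (+-identityˡ _)

  module _ {k m} (ι : Fin k → Fin m) (ι-injective : Injective _≡_ _≡_ ι) where

    -- Double counting over the graph of ι: `δ` is `f l` at the pairs with ι t = l and 0 elsewhere.
    -- Injectivity leaves at most one such pair for each `l`.
    sum-support : (f : Vector Carrier m) → (∀ l → ¬ (∃[ t ] ι t ≡ l) → f l ≈ 0#) →
                  sum f ≈ sum (f ∘ ι)
    sum-support f f≈0 = begin
      ∑[ l < m ] f l                  ≈⟨ sum-cong-≋ fibre ⟨
      ∑[ l < m ] ∑[ t < k ] δ t l     ≈⟨ ∑-comm (λ l t → δ t l) ⟩
      ∑[ t < k ] ∑[ l < m ] δ t l     ≈⟨ sum-cong-≋ image ⟩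
      ∑[ t < k ] f (ι t)              ∎
      where
      δ : Fin k → Fin m → Carrier
      δ t l with ι t ≟ l
      ... | yes _ = f l
      ... | no _ = 0#

      hit : ∀ t l → ι t ≡ l → δ t l ≈ f l
      hit t l ιt≡l with ι t ≟ l
      ... | yes _ = refl
      ... | no ιt≢l = contradiction ιt≡l ιt≢l

      miss : ∀ t l → ι t ≢ l → δ t l ≈ 0#
      miss t l ιt≢l with ι t ≟ l
      ... | yes ιt≡l = contradiction ιt≡l ιt≢l
      ... | no _ = refl

      fibre : ∀ l → ∑[ t < k ] δ t l ≈ f l
      fibre l with any? (λ t → ι t ≟ l)
      ... | yes (t , ιt≡l) = trans
              (sum-single t (λ s → δ s l) λ s s≢t → miss s l λ ιs≡l →
                s≢t (ι-injective (≡.trans ιs≡l (≡.sym ιt≡l))))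
              (hit t l ιt≡l)
      ... | no l∉ι = trans (sum-zero (λ t → δ t l) λ t → miss t l λ ιt≡l → l∉ι (t , ιt≡l))
              (sym (f≈0 l l∉ι))

      image : ∀ t → ∑[ l < m ] δ t l ≈ f (ι t)
      image t = trans (sum-single (ι t) (δ t) λ l l≢ιt → miss t l (l≢ιt ∘ ≡.sym))
                      (hit t (ι t) ≡.refl)

    extend : ∀ {n} → Vector (Matrix n) k → Vector (Matrix n) m
    extend W l with any? (λ t → ι t ≟ l)
    ... | yes (t , _) = W t
    ... | no _ = λ _ _ → 0#

    -- The search may return any preimage of ι t; injectivity identifies it with t.
    extend-image : ∀ {n} (W : Vector (Matrix n) k) t → extend W (ι t) ≡ W t
    extend-image W t with any? (λ s → ι s ≟ ι t)
    ... | yes (s , ιs≡ιt) = ≡.cong W (ι-injective ιs≡ιt)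
    ... | no ιt∉ι = contradiction (t , ≡.refl) ιt∉ι

    extend-outside : ∀ {n} (W : Vector (Matrix n) k) l → ¬ (∃[ t ] ι t ≡ l) →
                     extend W l ≡ λ _ _ → 0#
    extend-outside W l l∉ι with any? (λ t → ι t ≟ l)
    ... | yes l∈ι = contradiction l∈ι l∉ι
    ... | no _ = ≡.refl

    diagonalForm-extend : ∀ {n} (a : Vector Carrier m) (W : Vector (Matrix n) k) →
                          diagonalForm a (extend W) ≋ diagonalForm (a ∘ ι) W
    diagonalForm-extend {n} a W i j = trans
      (sum-support (λ l → a l * (extend W l ⊠ extend W l) i j) λ l l∉ι → begin
        a l * (extend W l ⊠ extend W l) i j
          ≡⟨ ≡.cong (λ X → a l * (X ⊠ X) i j) (extend-outside W l l∉ι) ⟩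
        a l * sum {n} (λ _ → 0# * 0#)
          ≈⟨ *-congˡ (sum-zero {n} _ λ _ → zeroˡ 0#) ⟩
        a l * 0#
          ≈⟨ zeroʳ (a l) ⟩
        0# ∎)
      (sum-cong-≋ λ t →
        reflexive (≡.cong (λ X → a (ι t) * (X ⊠ X) i j) (extend-image W t)))

    -- Zero matrices outside the image of ι contribute nothing, so it is enough to treat the subform
    -- of three unit coefficients.
    universal-extend : ∀ {n} (a : Vector Carrier m) → Universal n (a ∘ ι) → Universal n a
    universal-extend a universal A =
      let W , A≋ = universal A
      in extend W , λ i j → trans (A≋ i j) (sym (diagonalForm-extend a W i j))

-- Divisibility by p and units in ℤₚ

module _ (p : ℕ) where

  open CommutativeRing (ℤₚ-commutativeRing p) hiding (zero)

  fromℤ-homomorphism : ℤ.+-*-rawRing -Raw-AlmostCommutative⟶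
                       fromCommutativeRing (ℤₚ-commutativeRing p)
  fromℤ-homomorphism = record
    { ⟦_⟧ = fromℤ
    ; +-homo = λ _ _ → pointwise λ _ → ≡.refl
    ; *-homo = λ _ _ → pointwise λ _ → ≡.refl
    ; -‿homo = λ _ → pointwise λ _ → ≡.refl
    ; 0-homo = pointwise λ _ → ≡.refl
    ; 1-homo = pointwise λ _ → ≡.refl
    }

  open DiagonalForms (ℤₚ-commutativeRing p)
  open Representation (ℤₚ-commutativeRing p) fromℤ-homomorphism

  pos-^ : ∀ k → + (p ℕ.^ suc k) ≡ + p ℤ.* + (p ℕ.^ k)
  pos-^ k = ℤ.pos-* p (p ℕ.^ k)

  pᵏ∣pᵏ⁺¹ : ∀ k → + (p ℕ.^ k) ∣ + (p ℕ.^ suc k)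
  pᵏ∣pᵏ⁺¹ k = divides (+ p) (pos-^ k)

  p∣pᵏ⁺¹ : ∀ k → + p ∣ + (p ℕ.^ suc k)
  p∣pᵏ⁺¹ k = divides (+ (p ℕ.^ k)) (≡.trans (pos-^ k) (ℤ.*-comm (+ p) _))

  -- Coherence makes all residues from index 1 on congruent modulo p; the residue at index 0 is only
  -- known modulo 1.
  p∣residue : ∀ (x : ℤₚ p) → + p ∣ residue x 1 → ∀ k → + p ∣ residue x (suc k)
  p∣residue x p∣x₁ zero = p∣x₁
  p∣residue x p∣x₁ (suc k) =
    ≡.subst (+ p ∣_) (rearrange (residue x (suc (suc k))) (residue x (suc k)))
      (∣m∣n⇒∣m+n (∣-trans (p∣pᵏ⁺¹ k) (coherent x (suc k))) (p∣residue x p∣x₁ k))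
    where
    rearrange : ∀ i j → i ℤ.- j ℤ.+ j ≡ i
    rearrange = solve-∀

  -- The residue of x / p modulo pᵏ is read off from that of x modulo pᵏ⁺¹.
  divide-by-p : .{{ℕ.NonZero p}} → ∀ (x : ℤₚ p) → + p ∣ residue x 1 → ∃[ h ] x ≈ fromℤ (+ p) * h
  divide-by-p x p∣x₁ = mkℤₚ q q-coherent , mk≈ₚ λ k →
    ≡.subst (λ i → + (p ℕ.^ k) ∣ residue x k ℤ.- i) (x≡pq k)
      (≡mod-sym {a = residue x (suc k)} (coherent x k))
    where
    q : ℕ → ℤ
    q k = _∣_.quotient (p∣residue x p∣x₁ k)

    x≡pq : ∀ k → residue x (suc k) ≡ + p ℤ.* q k
    x≡pq k = ≡.trans (_∣_.equality (p∣residue x p∣x₁ k)) (ℤ.*-comm (q k) (+ p))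

    factor : ∀ i j n → n ℤ.* i ℤ.- n ℤ.* j ≡ n ℤ.* (i ℤ.- j)
    factor = solve-∀

    q-coherent : ∀ k → q (suc k) ≡ q k [mod + (p ℕ.^ k) ]
    -- Coherence of x one level higher says that pᵏ⁺¹ divides p (q (k + 1) - q k); cancel p.
    q-coherent k = *-cancelˡ-∣ (+ p) (≡.subst₂ _∣_ (pos-^ k)
      (≡.trans (≡.cong₂ ℤ._-_ (x≡pq (suc k)) (x≡pq k)) (factor (q (suc k)) (q k) (+ p)))
      (coherent x (suc k)))

  -- Inverses modulo pᵏ are unique modulo pᵏ, so independent choices at each level are automatically
  -- coherent; `telescope` is the identity behind this.
  inverses⇒unit : ∀ (x : ℤₚ p) →
                  (∀ k → ∃[ y ] residue x k ℤ.* y ≡ 1ℤ [mod + (p ℕ.^ k) ]) → IsUnit x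
  inverses⇒unit x inverse = unit {x} (mkℤₚ y y-coherent) (mk≈ₚ λ k → proj₂ (inverse k))
    where
    y : ℕ → ℤ
    y k = proj₁ (inverse k)

    telescope : ∀ x₁ x₀ y₁ y₀ →
      ℤ.- y₁ ℤ.* (x₀ ℤ.* y₀ ℤ.- 1ℤ) ℤ.+ y₀ ℤ.* (x₁ ℤ.* y₁ ℤ.- 1ℤ) ℤ.+
      ℤ.- (y₀ ℤ.* y₁) ℤ.* (x₁ ℤ.- x₀) ≡ y₁ ℤ.- y₀
    telescope = solve-∀

    y-coherent : ∀ k → y (suc k) ≡ y k [mod + (p ℕ.^ k) ]
    y-coherent k = ≡.subst (+ (p ℕ.^ k) ∣_)
      (telescope (residue x (suc k)) (residue x k) (y (suc k)) (y k))
      (∣m∣n⇒∣m+n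
        (∣m∣n⇒∣m+n
          (∣n⇒∣m*n (ℤ.- y (suc k)) (proj₂ (inverse k)))
          (∣n⇒∣m*n (y k) (∣-trans (pᵏ∣pᵏ⁺¹ k) (proj₂ (inverse (suc k))))))
        (∣n⇒∣m*n (ℤ.- (y k ℤ.* y (suc k))) (coherent x k)))

  -- The inverses are partial sums of the geometric series in -p h: replacing y by 1 - p h y
  -- multiplies the error (1 + p h) y - 1 by -p h.
  1+p-multiple-unit : ∀ h → IsUnit (1# + fromℤ (+ p) * h)
  1+p-multiple-unit h = inverses⇒unit (1# + fromℤ (+ p) * h) λ k → inverse (residue h k) k
    where
    expand : ∀ n h y → (1ℤ ℤ.+ n ℤ.* h) ℤ.* (1ℤ ℤ.- n ℤ.* h ℤ.* y) ℤ.- 1ℤ ≡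
                       n ℤ.* (ℤ.- h ℤ.* ((1ℤ ℤ.+ n ℤ.* h) ℤ.* y ℤ.- 1ℤ))
    expand = solve-∀

    inverse : ∀ h k → ∃[ y ] (1ℤ ℤ.+ + p ℤ.* h) ℤ.* y ≡ 1ℤ [mod + (p ℕ.^ k) ]
    -- Modulo p⁰ = 1 every congruence holds, so the iteration may start at 1.
    inverse h zero = 1ℤ , divides n (≡.sym (ℤ.*-identityʳ n))
      where n = (1ℤ ℤ.+ + p ℤ.* h) ℤ.* 1ℤ ℤ.- 1ℤ
    inverse h (suc k) =
      let y , y-eq = inverse h k
      in 1ℤ ℤ.- + p ℤ.* h ℤ.* y ,
         ≡.subst₂ _∣_ (≡.sym (pos-^ k)) (≡.sym (expand (+ p) h y))
           (*-monoʳ-∣ (+ p) (∣n⇒∣m*n (ℤ.- h) y-eq))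

  -- 2 · (-j) = 1 - p, which is a unit by the geometric series.
  odd⇒2-unit : ∀ j → p ≡ 1 ℕ.+ j ℕ.* 2 → IsUnit 2#
  odd⇒2-unit j p≡1+2j = factor-unit {2#} {fromℤ (ℤ.- + j)} {1# + fromℤ (+ p) * fromℤ -1ℤ}
    (pointwise λ _ → ≡.trans (expand (+ j))
      (≡.cong (λ i → 1ℤ ℤ.+ i ℤ.* -1ℤ) (≡.sym +p≡1+2j)))
    (1+p-multiple-unit (fromℤ -1ℤ))
    where
    +p≡1+2j : + p ≡ 1ℤ ℤ.+ + j ℤ.* + 2
    +p≡1+2j = ≡.trans (≡.cong +_ p≡1+2j) (≡.cong (λ i → 1ℤ ℤ.+ i) (ℤ.pos-* j 2))

    expand : ∀ i → (1ℤ ℤ.+ 1ℤ) ℤ.* (ℤ.- i) ≡ 1ℤ ℤ.+ (1ℤ ℤ.+ i ℤ.* + 2) ℤ.* -1ℤ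
    expand = solve-∀

-- Parity in ℤ₂

module _ where

  open CommutativeRing (ℤₚ-commutativeRing 2)
  open DiagonalForms (ℤₚ-commutativeRing 2)
  open Representation (ℤₚ-commutativeRing 2) (fromℤ-homomorphism 2)

  divide-by-2 : ∀ (x : ℤₚ 2) → + 2 ∣ residue x 1 → Even x
  -- The proof is rewrapped because `fromℤ (+ 2)` and `2#` need only agree on residues, where 1 + 1
  -- computes to 2.
  divide-by-2 x 2∣x₁ = let h , x≈2h = divide-by-p 2 x 2∣x₁ in h , mk≈ₚ (residue-≈ x≈2h)

  parity-residue : ∀ i → + 2 ∣ i ⊎ + 2 ∣ i ℤ.- 1ℤ
  parity-residue i with i ℤ.%ℕ 2 | ℤ.n%ℕd<d i 2 | ℤ.a≡a%ℕn+[a/ℕn]*n i 2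
  ... | 0 | _ | eq = inj₁ (divides (i ℤ./ℕ 2) (≡.trans eq (ℤ.+-identityˡ _)))
  ... | 1 | _ | eq = inj₂ (divides (i ℤ./ℕ 2)
          (≡.trans (≡.cong (ℤ._- 1ℤ) eq) (cancel (i ℤ./ℕ 2 ℤ.* + 2))))
    where
    cancel : ∀ i → 1ℤ ℤ.+ i ℤ.- 1ℤ ≡ i
    cancel = solve-∀
  ... | suc (suc _) | s≤s (s≤s ()) | _

  -- The residue at index 1 decides; when it is odd, x - 1 is halved instead.
  parity : ∀ x → Even x ⊎ Odd x
  parity x = [ inj₁ ∘ divide-by-2 x , inj₂ ∘ odd ]′ (parity-residue (residue x 1))
    where
    shift : ∀ i j → i ℤ.- 1ℤ ℤ.- j ≡ i ℤ.- (1ℤ ℤ.+ j)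
    shift = solve-∀

    odd : + 2 ∣ residue x 1 ℤ.- 1ℤ → Odd x
    odd 2∣x₁-1 =
      let h , x-1≈2h = divide-by-2 (x + - 1#) 2∣x₁-1
      in h , mk≈ₚ λ k → ≡.subst (+ (2 ℕ.^ k) ∣_)
           (shift (residue x k) (residue (2# * h) k)) (residue-≈ x-1≈2h k)

  odd-unit : ∀ x → Odd x → IsUnit x
  odd-unit x (h , x≈1+2h) = unit-cong {1# + fromℤ (+ 2) * h} {x}
    (mk≈ₚ λ k → ≡mod-sym {a = residue x k} (residue-≈ x≈1+2h k)) (1+p-multiple-unit 2 h)

-- Primes and the bound on f(3)

prime-odd : ∀ {p} → Prime p → p ≢ 2 → ∃[ j ] p ≡ 1 ℕ.+ j ℕ.* 2
prime-odd {p} p-prime p≢2 with p ℕ.% 2 | m%n<n p 2 | m≡m%n+[m/n]*n p 2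
... | 0 | _ | eq = contradiction (prime⇒irreducible p-prime (ℕ.divides (p ℕ./ 2) eq))
                     λ { (inj₁ ()) ; (inj₂ 2≡p) → p≢2 (≡.sym 2≡p) }
... | 1 | _ | eq = p ℕ./ 2 , eq
... | suc (suc _) | s≤s (s≤s ()) | _

UnitTriplesUniversal : ℕ → Set
UnitTriplesUniversal p = ∀ a → (∀ t → IsUnit (a t)) → Universal {3} 3 a
  where open DiagonalForms (ℤₚ-commutativeRing p)

unit-triples-universal : ∀ {p} → Prime p → Dec (p ≡ 2) → UnitTriplesUniversal p
unit-triples-universal _ (yes ≡.refl) a ua A =
  Representation.representable-parity (ℤₚ-commutativeRing 2) (fromℤ-homomorphism 2)
    a ua A parity odd-unit
unit-triples-universal {p} p-prime (no p≢2) a ua A =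
  Representation.representable-2-unit (ℤₚ-commutativeRing p) (fromℤ-homomorphism p)
    a ua A (odd⇒2-unit p (proj₁ p-odd) (proj₂ p-odd))
  where p-odd = prime-odd p-prime p≢2

-- Three unit coefficients already represent every matrix; the other variables are set to zero.
admissible : ∀ {p m} → Prime p → 3 ≤ m → Admissible p 3 m
admissible {p} p-prime 3≤m = 3≤m , λ a (ι , ι-injective , ua) →
  Padding.universal-extend (ℤₚ-commutativeRing p) ι ι-injective a
    (unit-triples-universal p-prime (p ℕ.≟ 2) (a ∘ ι) ua)

-- The first component keeps the bound from holding merely because no number is admissible.
theorem3p1 : ∀ (p : ℕ) → Prime p →
    ∃ (λ m → Admissible p 3 m) × (∀ m → f[ p , 3 ]≡ m → m ≤ 4)
theorem3p1 p p-prime = (4 , admissible₄) , λ m (_ , minimal) → minimal 4 admissible₄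
  where
  admissible₄ : Admissible p 3 4
  admissible₄ = admissible p-prime (ℕ.m≤m+n 3 1)
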